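{- Let $M\leq N$ be positive integers and let $k$ be a positive integer. Then an array of type $I_k(2^M,2^N,2,3)$ exists if and only if $3\leq k\leq M+N$, $3\leq M$, $k\leq 2^{M-1}$ and $(k,M,N)\notin\{(4,3,3),(8,4,4)\}$.
   Context: For an integer $s\ge 1$ let $[s]=\{0,1,\dots,s-1\}$. An orthogonal array OA$(n,k,q,t)$ (size $n$, degree $k$, $q$ levels, strength $t$, $1\le t\leq k$) is an $n\times k$ array with entries from $[q]$ such that in every $n\times t$ submatrix (choice of $t$ columns), every vector of $[q]^t$ appears as a row exactly $n/q^t$ times. An array of type $I_k(m,n,q,t)$ (an $m\times n$ row-column factorial design $q^k$ of strength $t$; it presupposes $t\le k$) is an $m\times n$ array whose cells each contain a vector of $[q]^k$ such that: (i) each vector of $[q]^k$ occurs in exactly $\lambda=mn/q^k$ cells (so $q^k\mid mn$); (ii) for each row of the array, the $n$ vectors in that row are the rows of an OA$(n,k,q,t)$; (iii) for each column of the array, the $m$ vectors in that column are the rows of an OA$(m,k,q,t)$. -}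

module Defs where

open import Data.Nat.Base using (ℕ; _*_; _^_; _≤_)
open import Data.Fin.Base using (Fin)
open import Data.Fin.Properties using (_≟_)
open import Data.Product.Base using (∃)
open import Data.Vec.Base using (Vec; concat; count; lookup; map; tabulate)
open import Data.Vec.Properties using (≡-dec)
open import Function.Base using (_∘_)
open import Function.Bundles using (_↣_; module Injection)
open import Relation.Binary.PropositionalEquality.Core using (_≡_)

Word : ℕ → ℕ → Set
Word q k = Vec (Fin q) k

occurrences : ∀ {q k n} → Word q k → Vec (Word q k) n → ℕ
occurrences w = count (≡-dec _≟_ w)

select : ∀ {q k t} → Fin t ↣ Fin k → Word q k → Word q t
select c w = tabulate (lookup w ∘ Injection.to c)

-- A choice of t columns is an injection, so the columns may be listed in any
-- order; since all words of length t are treated alike, the order is immaterial.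
-- "Exactly n / q ^ t times" is an equation between rationals (q ≥ 1), hence it
-- is stated by clearing the denominator: in particular q ^ t divides n.
record IsOA (n k q t : ℕ) (A : Vec (Word q k) n) : Set where
  field
    1≤t      : 1 ≤ t
    t≤k      : t ≤ k
    balanced : ∀ (c : Fin t ↣ Fin k) (w : Word q t) →
               occurrences w (map (select c) A) * q ^ t ≡ n

Grid : (A : Set) → ℕ → ℕ → Set
Grid A m n = Vec (Vec A n) m

row : ∀ {A m n} → Grid A m n → Fin m → Vec A n
row = lookup

column : ∀ {A m n} → Grid A m n → Fin n → Vec A m
column G j = map (λ r → lookup r j) G

record IsFactorialDesign (k m n q t : ℕ) (G : Grid (Word q k) m n) : Set where
  field
    t≤k         : t ≤ k
    cells       : ∀ (w : Word q k) → occurrences w (concat G) * q ^ k ≡ m * n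
    rows-OA     : ∀ i → IsOA n k q t (row G i)
    columns-OA  : ∀ j → IsOA m k q t (column G j)

-- There is an array of type I_k(m,n,q,t).
ExistsI : (k m n q t : ℕ) → Set
ExistsI k m n q t = ∃ (IsFactorialDesign k m n q t)

module Submission where

-- Sufficiency.  Let cell (x , y), with x and y binary vectors of lengths M and N, hold the word whose
-- r-th letter is aᵣ · x + bᵣ · y.  Rows and columns have strength 3 if any three of the bᵣ, and any three
-- of the aᵣ, are linearly independent, and all words occur equally often if the concatenations aᵣ bᵣ are
-- linearly independent.  Taking aᵣ = 1 a′ᵣ with distinct a′ᵣ settles the condition on a.  Adding a
-- coordinate to b allows one more letter as long as k < 2 ^ (M - 1); adding one to both a and b allows two
-- more, so that for M ≥ 5 everything follows from a solution with M = N = 5 and k = 10.  The cases M = 3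
-- and M = 4 start from k = 0 and from M = N = 4, k = 7.
--
-- Necessity.  For a row x of an orthogonal array with n rows let χ j c = ±1 say whether row j agrees with x
-- in column c, and let T j be the sum of the χ j c.  Strength 3 gives Σⱼ (1 + χ j c) (T j)² = k n, whose
-- term for x itself is 2 k², hence 2 k ≤ n.  If n = 2 k, then all other terms vanish, so that any other
-- row has T = 0 or is the complement of x; when 4 ∣ k both force its weight to have the parity of that of x.
-- In the two exceptional cases all cells would then have the same parity.

open import Algebra.Bundles using (CommutativeRing)
open import Algebra.Properties.CommutativeSemigroup using (interchange)
open import Data.Bool.Base using (Bool; true; false; not; _∧_; _xor_; if_then_else_)
import Data.Bool.Properties as Bool
open import Data.Fin.Base using (Fin; zero; suc; toℕ; fromℕ<; combine; finToFun; funToFin; punchIn; punchOut)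
open import Data.Fin.Patterns using (0F; 1F; 2F)
open import Data.Fin.Properties using (_≟_; all?; any?; pigeonhole; 2↔Bool; <⇒≢; suc-injective; funToFin-finToFin; punchIn-punchOut)
open import Data.Integer.Base as ℤ using (ℤ; +_; -[1+_]; 0ℤ; 1ℤ; -1ℤ; +≤+)
import Data.Integer.Properties as ℤ
open import Algebra.Properties.Semiring.Sum ℤ.+-*-semiring
  using (sum; ∑-comm; *-distribˡ-sum; *-distribʳ-sum; sum-cong-≗; sum-remove; sum-replicate-zero)
open import Data.Integer.Tactic.RingSolver using (solve-∀)
open import Data.List.Base using ([]; _∷_)
open import Data.List.Membership.Propositional using (_∉_)
open import Data.List.Relation.Unary.Any using (here; there)
open import Data.Maybe.Base using (Maybe; just; nothing; from-just)
open import Data.Nat.Base using (ℕ; zero; suc; _+_; _∸_; _*_; _^_; _/_; _%_; _≡ᵇ_; _≤_; _<_; z≤n; s≤s)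
import Data.Nat.Properties as ℕ
open import Data.Nat.Tactic.RingSolver using () renaming (solve-∀ to solve-∀-ℕ)
open import Data.Product.Base using (∃; ∃₂; _×_; _,_; proj₁; proj₂)
open import Data.Sum.Base using (_⊎_; inj₁; inj₂; reduce)
open import Data.Unit.Base using (⊤; tt)
open import Data.Vec.Base using (Vec; []; _∷_; _++_; concat; count; lookup; map; replicate; tabulate; zipWith)
import Data.Vec.Functional as F
open import Data.Vec.Properties using (≡-dec; ∷-injectiveʳ; lookup-map; lookup∘tabulate; map-++; map-cong; map-∘; tabulate-cong; zipWith-assoc; zipWith-comm; zipWith-identityˡ; zipWith-identityʳ)
open import Function.Base using (_∘_; const)
open import Function.Bundles using (_⇔_; mk⇔; _↣_; mk↣; module Injection)
open import Function.Properties.Inverse using (↔⇒↣)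
open import Relation.Binary.PropositionalEquality using (_≡_; _≢_; _≗_; refl; sym; trans; cong; cong₂; subst; module ≡-Reasoning)
open import Relation.Nullary.Decidable using (Dec; yes; no; does; ¬?; _→-dec_; dec-true; dec-false; from-yes)
open import Relation.Nullary.Negation using (¬_; contradiction)
open import Defs

-- Linear algebra over the field with two elements.

Bits : ℕ → Set
Bits = Vec Bool

infixl 6 _⊕_
infix 7 _·_

_⊕_ : ∀ {n} → Bits n → Bits n → Bits n
_⊕_ = zipWith _xor_

𝟎 : ∀ {n} → Bits n
𝟎 = replicate _ false

_·_ : ∀ {n} → Bits n → Bits n → Bool
[]       · []       = false
(x ∷ xs) · (y ∷ ys) = (x ∧ y) xor (xs · ys)

xor-interchange : ∀ a b c d → (a xor b) xor (c xor d) ≡ (a xor c) xor (b xor d)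
xor-interchange = interchange (CommutativeRing.+-commutativeSemigroup Bool.xor-∧-commutativeRing)

·-distribˡ-⊕ : ∀ {n} (x u v : Bits n) → x · (u ⊕ v) ≡ (x · u) xor (x · v)
·-distribˡ-⊕ []       []       []       = refl
·-distribˡ-⊕ (x ∷ xs) (u ∷ us) (v ∷ vs) =
  trans (cong₂ _xor_ (Bool.∧-distribˡ-xor x u v) (·-distribˡ-⊕ xs us vs)) (xor-interchange (x ∧ u) (x ∧ v) _ _)

·-comm : ∀ {n} (x u : Bits n) → x · u ≡ u · x
·-comm []       []       = refl
·-comm (x ∷ xs) (u ∷ us) = cong₂ _xor_ (Bool.∧-comm x u) (·-comm xs us)

·-distribʳ-⊕ : ∀ {n} (u x y : Bits n) → (x ⊕ y) · u ≡ (x · u) xor (y · u)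
·-distribʳ-⊕ u x y = trans (·-comm (x ⊕ y) u) (trans (·-distribˡ-⊕ u x y) (cong₂ _xor_ (·-comm u x) (·-comm u y)))

·-zeroʳ : ∀ {n} (x : Bits n) → x · 𝟎 ≡ false
·-zeroʳ []       = refl
·-zeroʳ (x ∷ xs) = cong₂ _xor_ (Bool.∧-zeroʳ x) (·-zeroʳ xs)

·-++ : ∀ {m n} (a i : Bits m) (b j : Bits n) → (a ++ b) · (i ++ j) ≡ (a · i) xor (b · j)
·-++ []       []       b j = refl
·-++ (x ∷ xs) (y ∷ ys) b j = trans (cong ((x ∧ y) xor_) (·-++ xs ys b j)) (sym (Bool.xor-assoc (x ∧ y) _ _))

⊕-same : ∀ {n} (x : Bits n) → x ⊕ x ≡ 𝟎
⊕-same []       = refl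
⊕-same (x ∷ xs) = cong₂ _∷_ (Bool.xor-same x) (⊕-same xs)

⊕-cancelʳ : ∀ {n} (x y : Bits n) → (x ⊕ y) ⊕ y ≡ x
⊕-cancelʳ x y =
  trans (zipWith-assoc Bool.xor-assoc x y y) (trans (cong (x ⊕_) (⊕-same y)) (zipWith-identityʳ Bool.xor-identityʳ x))

⊕-move : ∀ {n} {x y z : Bits n} → x ⊕ y ≡ z → x ≡ z ⊕ y
⊕-move {x = x} {y} refl = sym (⊕-cancelʳ x y)

-- Counting points of the binary cube.

tally : ∀ n → (Bits n → Bool) → ℕ
tally zero    P = if P [] then 1 else 0
tally (suc n) P = tally n (P ∘ (false ∷_)) + tally n (P ∘ (true ∷_))

tally-cong : ∀ n {P Q : Bits n → Bool} → P ≗ Q → tally n P ≡ tally n Q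
tally-cong zero    P≗Q rewrite P≗Q [] = refl
tally-cong (suc n) P≗Q = cong₂ _+_ (tally-cong n (P≗Q ∘ (false ∷_))) (tally-cong n (P≗Q ∘ (true ∷_)))

tally-true : ∀ n → tally n (const true) ≡ 2 ^ n
tally-true zero    = refl
tally-true (suc n) = cong₂ _+_ (tally-true n) (trans (tally-true n) (sym (ℕ.+-identityʳ _)))

-- A coordinate of `u` equal to `true` only swaps the two halves of the cube, so commutativity of
-- addition replaces an explicit bijection.
tally-translate : ∀ n (u : Bits n) (P : Bits n → Bool) → tally n (P ∘ (u ⊕_)) ≡ tally n P
tally-translate zero    []          P = refl
tally-translate (suc n) (false ∷ u) P =
  cong₂ _+_ (tally-translate n u (P ∘ (false ∷_))) (tally-translate n u (P ∘ (true ∷_)))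
tally-translate (suc n) (true  ∷ u) P =
  trans (cong₂ _+_ (tally-translate n u (P ∘ (true ∷_))) (tally-translate n u (P ∘ (false ∷_))))
        (ℕ.+-comm (tally n (P ∘ (true ∷_))) _)

tally-split : ∀ n (P Q : Bits n → Bool) →
              tally n (λ x → P x ∧ Q x) + tally n (λ x → not (P x) ∧ Q x) ≡ tally n Q
tally-split zero    P Q with P []
... | true  = ℕ.+-identityʳ _
... | false = refl
tally-split (suc n) P Q =
  trans (interchange ℕ.+-commutativeSemigroup (tally n (λ x → P (false ∷ x) ∧ Q (false ∷ x))) _ _ _)
        (cong₂ _+_ (tally-split n (P ∘ (false ∷_)) (Q ∘ (false ∷_)))
                   (tally-split n (P ∘ (true ∷_)) (Q ∘ (true ∷_))))

-- Linear independence certified by dual vectors.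

Dual : ∀ {t n} → (Fin t → Bits n) → Bits n → Set
Dual d x = ∃ λ u → x · u ≡ true × ∀ s → d s · u ≡ false

-- Triangular systems of dual vectors witness linear independence.
Independent : ∀ {t n} → (Fin t → Bits n) → Set
Independent {zero}  d = ⊤
Independent {suc t} d = Dual (d ∘ suc) (d zero) × Independent (d ∘ suc)

bit : Bool → Fin 2
bit false = 0F
bit true  = 1F

≟-bit-not : ∀ w b → does (w ≟ bit (not b)) ≡ not (does (w ≟ bit b))
≟-bit-not 0F false = refl
≟-bit-not 0F true  = refl
≟-bit-not 1F false = refl
≟-bit-not 1F true  = refl

encode : ∀ {t} → (Fin t → Bool) → Word 2 t
encode f = tabulate (bit ∘ f)

matches : ∀ {t} → Word 2 t → (Fin t → Bool) → Bool
matches w f = does (≡-dec _≟_ w (encode f))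

matches-cong : ∀ {t} (w : Word 2 t) {f g : Fin t → Bool} → f ≗ g → matches w f ≡ matches w g
matches-cong []       f≗g = refl
matches-cong (w ∷ ws) f≗g = cong₂ _∧_ (cong (λ b → does (w ≟ bit b)) (f≗g zero)) (matches-cong ws (f≗g ∘ suc))

-- Translation by a dual vector of the first form negates that form and fixes the others, so the
-- fibres over w ∷ ws for the two values of w have equal size.
fibre-size : ∀ {t n} (d : Fin t → Bits n) (e : Fin t → Bool) → Independent d → (w : Word 2 t) →
             tally n (λ x → matches w (λ s → e s xor d s · x)) * 2 ^ t ≡ 2 ^ n
fibre-size {zero}  {n} d e _ [] = trans (ℕ.*-identityʳ _) (tally-true n)
fibre-size {suc t} {n} d e ((u , du , ds) , ind) (w ∷ ws) = begin
  c * (2 ^ t + (2 ^ t + 0))           ≡⟨ cong (c *_) (cong (λ z → 2 ^ t + z) (ℕ.+-identityʳ _)) ⟩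
  c * (2 ^ t + 2 ^ t)                 ≡⟨ ℕ.*-distribˡ-+ c (2 ^ t) (2 ^ t) ⟩
  c * 2 ^ t + c * 2 ^ t               ≡⟨ sym (ℕ.*-distribʳ-+ (2 ^ t) c c) ⟩
  (c + c) * 2 ^ t                     ≡⟨ cong (λ z → (c + z) * 2 ^ t)
                                             (trans (sym (tally-translate n u (λ x → P x ∧ Q x))) (tally-cong n shift)) ⟩
  (c + tally n (λ x → not (P x) ∧ Q x)) * 2 ^ t ≡⟨ cong (_* 2 ^ t) (tally-split n P Q) ⟩
  tally n Q * 2 ^ t                   ≡⟨ fibre-size (d ∘ suc) (e ∘ suc) ind ws ⟩
  2 ^ n                               ∎
  where
  open ≡-Reasoning
  P Q : Bits n → Bool
  P x = does (w ≟ bit (e zero xor d zero · x))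
  Q x = matches ws (λ s → e (suc s) xor d (suc s) · x)
  c = tally n (λ x → P x ∧ Q x)
  xor-not : ∀ a b → a xor not b ≡ not (a xor b)
  xor-not false b = refl
  xor-not true  b = refl
  moved : ∀ x → e zero xor d zero · (u ⊕ x) ≡ not (e zero xor d zero · x)
  moved x rewrite ·-distribˡ-⊕ (d zero) u x | du = xor-not (e zero) _
  fixed : ∀ x s → e (suc s) xor d (suc s) · (u ⊕ x) ≡ e (suc s) xor d (suc s) · x
  fixed x s rewrite ·-distribˡ-⊕ (d (suc s)) u x | ds s = refl
  shift : ∀ x → P (u ⊕ x) ∧ Q (u ⊕ x) ≡ not (P x) ∧ Q x
  shift x = cong₂ _∧_ (trans (cong (λ b → does (w ≟ bit b)) (moved x)) (≟-bit-not w _)) (matches-cong ws (fixed x))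

Span : ∀ {t n} → (Fin t → Bits n) → Bits n → Set
Span {zero}  d x = x ≡ 𝟎
Span {suc t} d x = Span (d ∘ suc) x ⊎ Span (d ∘ suc) (x ⊕ d zero)

zero-or-dual : ∀ {n} (x : Bits n) → x ≡ 𝟎 ⊎ ∃ λ u → x · u ≡ true
zero-or-dual []           = inj₁ refl
zero-or-dual (true  ∷ xs) = inj₂ (true ∷ 𝟎 , cong not (·-zeroʳ xs))
zero-or-dual (false ∷ xs) with zero-or-dual xs
... | inj₁ xs≡𝟎     = inj₁ (cong (false ∷_) xs≡𝟎)
... | inj₂ (u , xu) = inj₂ (false ∷ u , xu)

-- Gaussian elimination on functionals. A functional `u` separating `x` from the later generators is
-- kept if it vanishes on `d zero`; otherwise it is corrected by a functional `v` that separates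
-- `x ⊕ d zero` from them.
span-or-dual : ∀ {t n} (d : Fin t → Bits n) x → Span d x ⊎ Dual d x
span-or-dual {zero}  d x with zero-or-dual x
... | inj₁ x≡𝟎      = inj₁ x≡𝟎
... | inj₂ (u , xu) = inj₂ (u , xu , λ ())
span-or-dual {suc t} d x with span-or-dual (d ∘ suc) x
... | inj₁ x∈ = inj₁ (inj₁ x∈)
... | inj₂ (u , xu , du) with d zero · u in d₀u
... | false = inj₂ (u , xu , λ { zero → d₀u ; (suc s) → du s })
... | true  with span-or-dual (d ∘ suc) (x ⊕ d zero)
... | inj₁ x∈ = inj₁ (inj₂ x∈)
-- Since `v` is `true` on `x ⊕ d zero`, it is `true` on exactly one of `x` and `d zero`.
... | inj₂ (v , xv , dv) with x · v in eqx | d zero · v in eqd | trans (sym (·-distribʳ-⊕ v x (d zero))) xv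
... | true  | false | _ = inj₂ (v , eqx , λ { zero → eqd ; (suc s) → dv s })
-- Both `u` and `v` are `true` on `d zero`, so their sum vanishes there, while on `x` only `u`
-- contributes.
... | false | true  | _ = inj₂ (u ⊕ v , trans (·-distribˡ-⊕ x u v) (cong₂ _xor_ xu eqx) ,
  λ { zero    → trans (·-distribˡ-⊕ (d zero) u v) (cong₂ _xor_ d₀u eqd)
    ; (suc s) → trans (·-distribˡ-⊕ (d (suc s)) u v) (cong₂ _xor_ (du s) (dv s)) })

-- Not a decision procedure, only a way to have independence certified by evaluation.
independent? : ∀ {t n} (d : Fin t → Bits n) → Maybe (Independent d)
independent? {zero}  d = just tt
independent? {suc t} d with span-or-dual (d ∘ suc) (d zero) | independent? (d ∘ suc)
... | inj₂ dual | just ind = just (dual , ind)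
... | _         | _        = nothing

¬span⇒dual : ∀ {t n} (d : Fin t → Bits n) {x} → ¬ Span d x → Dual d x
¬span⇒dual d {x} x∉ with span-or-dual d x
... | inj₁ x∈ = contradiction x∈ x∉
... | inj₂ dual = dual

-- Caps.

-- Any three distinct members of a cap are linearly independent; taking j = l shows that 𝟎 is not a member.
record Cap {k n} (b : Fin k → Bits n) : Set where
  constructor cap
  field
    injective : ∀ {i j} → b i ≡ b j → i ≡ j
    sum-free  : ∀ i j l → b i ≢ b j ⊕ b l

⊕≡𝟎⇒≡ : ∀ {n} {x y : Bits n} → x ⊕ y ≡ 𝟎 → x ≡ y
⊕≡𝟎⇒≡ {x = []}         {[]}         eq = refl
⊕≡𝟎⇒≡ {x = false ∷ xs} {false ∷ ys} eq = cong (false ∷_) (⊕≡𝟎⇒≡ (∷-injectiveʳ eq))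
⊕≡𝟎⇒≡ {x = true  ∷ xs} {true  ∷ ys} eq = cong (true ∷_) (⊕≡𝟎⇒≡ (∷-injectiveʳ eq))

cap-nonzero : ∀ {k n} {b : Fin k → Bits n} → Cap b → ∀ i → b i ≢ 𝟎
cap-nonzero {b = b} C i bi≡𝟎 = Cap.sum-free C i i i (trans bi≡𝟎 (sym (⊕-same (b i))))

-- Membership in a span unfolds into one equation per subset of the generators. One vector alone
-- contradicts `cap-nonzero`, a sum of two contradicts injectivity, and the sum of all three
-- contradicts `sum-free`.
cap-independent : ∀ {k n} {b : Fin k → Bits n} → Cap b → (c : Fin 3 ↣ Fin k) →
                  Independent (b ∘ Injection.to c)
cap-independent {b = b} C c =
    ¬span⇒dual (F.tail v) (λ
      { (inj₁ (inj₁ x≡𝟎)) → cap-nonzero C _ x≡𝟎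
      ; (inj₁ (inj₂ x⊕z)) → distinct {0F} {2F} (λ ()) (⊕≡𝟎⇒≡ x⊕z)
      ; (inj₂ (inj₁ x⊕y)) → distinct {0F} {1F} (λ ()) (⊕≡𝟎⇒≡ x⊕y)
      ; (inj₂ (inj₂ xyz)) → Cap.sum-free C (to 0F) (to 2F) (to 1F) (⊕-move (⊕≡𝟎⇒≡ xyz)) })
  , ¬span⇒dual (F.tail (F.tail v)) (λ
      { (inj₁ y≡𝟎) → cap-nonzero C _ y≡𝟎
      ; (inj₂ y⊕z) → distinct {1F} {2F} (λ ()) (⊕≡𝟎⇒≡ y⊕z) })
  , ¬span⇒dual (F.tail (F.tail (F.tail v))) (cap-nonzero C _)
  , tt
  where
  to = Injection.to c
  v = b ∘ to
  distinct : ∀ {i j} → i ≢ j → v i ≢ v j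
  distinct i≢j eq = i≢j (Injection.injective c (Cap.injective C eq))

-- Enumerating the cube and building designs from linear forms.

cube : ∀ n → Vec (Bits n) (2 ^ n)
cube zero    = [] ∷ []
-- The trailing `[]` follows the unfolding of `2 ^ suc n` to `2 ^ n + (2 ^ n + 0)`, which avoids a
-- cast of lengths.
cube (suc n) = map (false ∷_) (cube n) ++ map (true ∷_) (cube n) ++ []

module _ {A : Set} {P : A → Set} (P? : ∀ x → Dec (P x)) where

  count-++ : ∀ {m n} (xs : Vec A m) (ys : Vec A n) → count P? (xs ++ ys) ≡ count P? xs + count P? ys
  count-++ []       ys = refl
  count-++ (x ∷ xs) ys with does (P? x)
  ... | true  = cong suc (count-++ xs ys)
  ... | false = count-++ xs ys

  count-concat-++ : ∀ {m n l} (xs : Vec (Vec A l) m) (ys : Vec (Vec A l) n) →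
                    count P? (concat (xs ++ ys)) ≡ count P? (concat xs) + count P? (concat ys)
  count-concat-++ []       ys = refl
  count-concat-++ (x ∷ xs) ys = begin
    count P? (x ++ concat (xs ++ ys))                              ≡⟨ count-++ x _ ⟩
    count P? x + count P? (concat (xs ++ ys))                      ≡⟨ cong (λ z → count P? x + z) (count-concat-++ xs ys) ⟩
    count P? x + (count P? (concat xs) + count P? (concat ys))     ≡⟨ sym (ℕ.+-assoc (count P? x) _ _) ⟩
    count P? x + count P? (concat xs) + count P? (concat ys)       ≡⟨ cong (_+ _) (sym (count-++ x (concat xs))) ⟩
    count P? (x ++ concat xs) + count P? (concat ys)               ∎
    where open ≡-Reasoning

  count-cube : ∀ n (f : Bits n → A) → count P? (map f (cube n)) ≡ tally n (does ∘ P? ∘ f)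
  count-cube zero    f with does (P? (f []))
  ... | true  = refl
  ... | false = refl
  count-cube (suc n) f
    rewrite map-++ f (map (false ∷_) (cube n)) (map (true ∷_) (cube n) ++ [])
          | map-++ f (map (true ∷_) (cube n)) []
          | sym (map-∘ f (false ∷_) (cube n)) | sym (map-∘ f (true ∷_) (cube n))
          | count-++ (map (f ∘ (false ∷_)) (cube n)) (map (f ∘ (true ∷_)) (cube n) ++ [])
          | count-++ (map (f ∘ (true ∷_)) (cube n)) []
          | ℕ.+-identityʳ (count P? (map (f ∘ (true ∷_)) (cube n)))
    = cong₂ _+_ (count-cube n (f ∘ (false ∷_))) (count-cube n (f ∘ (true ∷_)))

  gridRow : ∀ {m n} → (Bits (m + n) → A) → Bits m → Vec A (2 ^ n)
  gridRow {n = n} f i = map (λ j → f (i ++ j)) (cube n)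

  -- Concatenating the rows of the grid enumerates the cube of dimension `m + n`; thus the condition
  -- on the cells becomes a fibre count for forms in `m + n` variables.
  count-grid : ∀ m n (f : Bits (m + n) → A) →
               count P? (concat (map (gridRow f) (cube m))) ≡
               tally (m + n) (does ∘ P? ∘ f)
  count-grid zero    n f = trans (trans (count-++ (map f (cube n)) []) (ℕ.+-identityʳ _)) (count-cube n f)
  count-grid (suc m) n f
    rewrite map-++ (gridRow {suc m} f) (map (false ∷_) (cube m)) (map (true ∷_) (cube m) ++ [])
          | map-++ (gridRow {suc m} f) (map (true ∷_) (cube m)) []
          | sym (map-∘ (gridRow {suc m} f) (false ∷_) (cube m)) | sym (map-∘ (gridRow {suc m} f) (true ∷_) (cube m))
          | count-concat-++ (map (gridRow f ∘ (false ∷_)) (cube m)) (map (gridRow f ∘ (true ∷_)) (cube m) ++ [])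
          | count-concat-++ (map (gridRow f ∘ (true ∷_)) (cube m)) []
          | ℕ.+-identityʳ (count P? (concat (map (gridRow f ∘ (true ∷_)) (cube m))))
    = cong₂ _+_ (count-grid m n (f ∘ (false ∷_))) (count-grid m n (f ∘ (true ∷_)))

-- The offsets `e` are there because fixing one of the two coordinates of a cell leaves an affine
-- map of the other; they record the contribution of the fixed one.
affine-OA : ∀ {k n} (b : Fin k → Bits n) (e : Fin k → Bool) → 3 ≤ k → Cap b →
            IsOA (2 ^ n) k 2 3 (map (λ x → encode (λ r → e r xor b r · x)) (cube n))
affine-OA {k} {n} b e 3≤k C = record
  { 1≤t = s≤s z≤n
  ; t≤k = 3≤k
  ; balanced = λ c w → trans (cong (_* 8) (occ c w)) (fibre-size (b ∘ Injection.to c) (e ∘ Injection.to c) (cap-independent C c) w)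
  }
  where
  word : Bits n → Word 2 k
  word x = encode (λ r → e r xor b r · x)
  occ : ∀ (c : Fin 3 ↣ Fin k) w → occurrences w (map (select c) (map word (cube n))) ≡
        tally n (λ x → matches w (λ s → e (Injection.to c s) xor b (Injection.to c s) · x))
  occ c w = begin
    occurrences w (map (select c) (map word (cube n)))  ≡⟨ cong (occurrences w) (sym (map-∘ (select c) word (cube n))) ⟩
    occurrences w (map (select c ∘ word) (cube n))      ≡⟨ count-cube (≡-dec _≟_ w) n (select c ∘ word) ⟩
    tally n (λ x → does (≡-dec _≟_ w (select c (word x)))) ≡⟨ tally-cong n (λ x → cong (λ v → does (≡-dec _≟_ w v))
         (tabulate-cong (λ s → lookup∘tabulate (λ r → bit (e r xor b r · x)) (Injection.to c s)))) ⟩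
    tally n (λ x → matches w (λ s → e (Injection.to c s) xor b (Injection.to c s) · x)) ∎
    where open ≡-Reasoning

-- All three balance conditions are instances of `fibre-size`: for triples of the `b r` in a row,
-- for triples of the `a r` in a column, and for all concatenations together in the whole grid.
linear-design : ∀ {k m n} (a : Fin k → Bits m) (b : Fin k → Bits n) → 3 ≤ k → Cap a → Cap b →
                Independent (λ r → a r ++ b r) → ExistsI k (2 ^ m) (2 ^ n) 2 3
linear-design {k} {m} {n} a b 3≤k A B ind = G , record
  { t≤k        = 3≤k
  ; cells      = λ w → trans (cong (_* 2 ^ k) (occ w)) (trans (fibre-size _ (const false) ind w) (ℕ.^-distribˡ-+-* 2 m n))
  ; rows-OA    = λ i → subst (IsOA (2 ^ n) k 2 3) (sym (rows i)) (affine-OA b (λ r → a r · lookup (cube m) i) 3≤k B)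
  ; columns-OA = λ j → subst (IsOA (2 ^ m) k 2 3) (sym (columns j)) (affine-OA a (λ r → b r · lookup (cube n) j) 3≤k A)
  }
  where
  open ≡-Reasoning
  word : Bits m → Bits n → Word 2 k
  word x y = encode (λ r → a r · x xor b r · y)
  G : Grid (Word 2 k) (2 ^ m) (2 ^ n)
  G = map (λ x → map (word x) (cube n)) (cube m)
  rows : ∀ i → row G i ≡ map (word (lookup (cube m) i)) (cube n)
  rows i = lookup-map i (λ x → map (word x) (cube n)) (cube m)
  columns : ∀ j → column G j ≡ map (λ x → encode (λ r → b r · lookup (cube n) j xor a r · x)) (cube m)
  columns j = trans (sym (map-∘ (λ r → lookup r j) _ (cube m)))
    (map-cong (λ x → trans (lookup-map j (word x) (cube n))
                           (tabulate-cong (λ r → cong bit (Bool.xor-comm (a r · x) _)))) (cube m))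
  word₂ : Bits (m + n) → Word 2 k
  word₂ z = encode (λ r → (a r ++ b r) · z)
  occ : ∀ w → occurrences w (concat G) ≡ tally (m + n) (λ z → matches w (λ r → (a r ++ b r) · z))
  occ w = trans
    (cong (occurrences w ∘ concat) (map-cong (λ x → map-cong (λ y → tabulate-cong (λ r → cong bit (sym (·-++ (a r) x (b r) y)))) (cube n)) (cube m)))
    (count-grid (≡-dec _≟_ w) m n word₂)

-- Fresh vectors and the extension of caps.

funToFin-cong : ∀ {m n} {g h : Fin m → Fin n} → g ≗ h → funToFin g ≡ funToFin h
funToFin-cong {zero}  g≗h = refl
funToFin-cong {suc m} g≗h = cong₂ combine (g≗h zero) (funToFin-cong (g≗h ∘ suc))

module _ {n : ℕ} where

  open Injection (↔⇒↣ 2↔Bool) using () renaming (to to isOne; injective to isOne-injective)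

  point : Fin (2 ^ n) → Bits n
  point p = tabulate (isOne ∘ finToFun {2} {n} p)

  point-injective : ∀ {p q} → point p ≡ point q → p ≡ q
  point-injective {p} {q} eq = begin
    p                              ≡⟨ sym (funToFin-finToFin {n} {2} p) ⟩
    funToFin (finToFun {2} {n} p)  ≡⟨ funToFin-cong (λ s → isOne-injective (trans (sym (lookup∘tabulate _ s))
                                        (trans (cong (λ v → lookup v s) eq) (lookup∘tabulate _ s)))) ⟩
    funToFin (finToFun {2} {n} q)  ≡⟨ funToFin-finToFin {n} {2} q ⟩
    q                              ∎
    where open ≡-Reasoning

  -- If `f` hit every point, choosing an index for each would map `2 ^ n` points to `k` indices; by
  -- the pigeonhole principle two distinct points would then coincide.
  fresh : ∀ {k} → k < 2 ^ n → (f : Fin k → Bits n) → ∃ λ x → ∀ i → x ≢ f i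
  fresh k<2ⁿ f with any? (λ p → all? (λ i → ¬? (≡-dec Bool._≟_ (point p) (f i))))
  ... | yes (p , p∉f) = point p , p∉f
  ... | no  covered   =
    let p , q , p<q , eq = pigeonhole k<2ⁿ (proj₁ ∘ owner)
    in contradiction
         (point-injective (trans (proj₂ (owner p)) (trans (cong f eq) (sym (proj₂ (owner q))))))
         (<⇒≢ p<q)
    where
    owner : ∀ p → ∃ λ i → point p ≡ f i
    owner p with any? (λ i → ≡-dec Bool._≟_ (point p) (f i))
    ... | yes found = found
    ... | no  none  = contradiction (p , λ i eq → none (i , eq)) covered

-- In characteristic two, a relation containing `x` once can be solved for `x` and is excluded by
-- hypothesis. If `x` occurs twice it cancels and leaves a zero member of `b`; if it occurs three
-- times, `x` itself is zero.
cap-∷ : ∀ {k n} {b : Fin k → Bits n} {x} → Cap b → x ≢ 𝟎 → (∀ i → x ≢ b i) →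
        (∀ i j → x ≢ b i ⊕ b j) → Cap (x F.∷ b)
cap-∷ {b = b} {x} C x≢𝟎 x≢b x≢b+b = cap injective sum-free
  where
  injective : ∀ {i j} → (x F.∷ b) i ≡ (x F.∷ b) j → i ≡ j
  injective {zero}  {zero}  eq = refl
  injective {zero}  {suc j} eq = contradiction eq (x≢b j)
  injective {suc i} {zero}  eq = contradiction (sym eq) (x≢b i)
  injective {suc i} {suc j} eq = cong suc (Cap.injective C eq)
  cancelˡ : ∀ {n} {y z : Bits n} → y ≡ y ⊕ z → z ≡ 𝟎
  cancelˡ {y = y} {z} eq = trans (⊕-move (trans (zipWith-comm Bool.xor-comm z y) (sym eq))) (⊕-same y)
  cancelʳ : ∀ {n} {y z : Bits n} → y ≡ z ⊕ y → z ≡ 𝟎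
  cancelʳ eq = cancelˡ (trans eq (zipWith-comm Bool.xor-comm _ _))
  sum-free : ∀ i j l → (x F.∷ b) i ≢ (x F.∷ b) j ⊕ (x F.∷ b) l
  sum-free zero    zero    zero    eq = x≢𝟎 (cancelˡ eq)
  sum-free zero    zero    (suc l) eq = cap-nonzero C l (cancelˡ eq)
  sum-free zero    (suc j) zero    eq = cap-nonzero C j (cancelʳ eq)
  sum-free zero    (suc j) (suc l) eq = x≢b+b j l eq
  sum-free (suc i) zero    zero    eq = cap-nonzero C i (trans eq (⊕-same x))
  sum-free (suc i) zero    (suc l) eq = x≢b+b i l (⊕-move (sym eq))
  sum-free (suc i) (suc j) zero    eq = x≢b+b i j (⊕-move (trans (zipWith-comm Bool.xor-comm x _) (sym eq)))
  sum-free (suc i) (suc j) (suc l) eq = Cap.sum-free C i j l eq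

cap-false∷ : ∀ {k n} {b : Fin k → Bits n} → Cap b → Cap ((false ∷_) ∘ b)
cap-false∷ C = cap (Cap.injective C ∘ ∷-injectiveʳ) (λ i j l → Cap.sum-free C i j l ∘ ∷-injectiveʳ)

-- A sum of two vectors with leading `true` has leading `false`, so it is never a member.
cap-true∷ : ∀ {k n} {a : Fin k → Bits n} → (∀ {i j} → a i ≡ a j → i ≡ j) → Cap ((true ∷_) ∘ a)
cap-true∷ inj = cap (inj ∘ ∷-injectiveʳ) (λ i j l ())

-- Configurations and their growth.

independent-embed : ∀ {t m n} (d : Fin t → Bits m) (d′ : Fin t → Bits n) (f : Bits m → Bits n) →
                    (∀ s u → d′ s · f u ≡ d s · u) → Independent d → Independent d′
independent-embed {zero}  d d′ f eq _ = tt
independent-embed {suc t} d d′ f eq ((u , du , ds) , ind) =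
    (f u , trans (eq zero u) du , λ s → trans (eq (suc s) u) (ds s))
  , independent-embed (d ∘ suc) (d′ ∘ suc) f (eq ∘ suc) ind

-- Position `m` is the boundary between the two parts of a concatenation, where a new leading
-- coordinate of the second part lands.
insert : ∀ m {n} → Bool → Bits (m + n) → Bits (m + suc n)
insert zero    c u       = c ∷ u
insert (suc m) c (x ∷ u) = x ∷ insert m c u

·-insert : ∀ {m n} (a : Bits m) (b : Bits n) x c u →
           (a ++ x ∷ b) · insert m c u ≡ (x ∧ c) xor ((a ++ b) · u)
·-insert []      b x c u       = refl
·-insert {suc m} (y ∷ a) b x c (z ∷ u) rewrite ·-insert a b x c u
  with y ∧ z | x ∧ c
... | false | _     = refl
... | true  | false = refl
... | true  | true  = refl

-- Here m = M - 1, and the vectors called aᵣ above are true ∷ a r.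
record Config (k m n : ℕ) : Set where
  field
    a           : Fin k → Bits m
    b           : Fin k → Bits n
    a-injective : ∀ {i j} → a i ≡ a j → i ≡ j
    b-cap       : Cap b
    independent : Independent (λ r → (true ∷ a r) ++ b r)

config-empty : ∀ {m n} → Config 0 m n
config-empty = record
  { a = λ () ; b = λ () ; a-injective = λ { {()} } ; b-cap = cap (λ { {()} }) (λ ()) ; independent = tt }

config-tail : ∀ {k m n} → Config (suc k) m n → Config k m n
config-tail C = record
  { a = a ∘ suc
  ; b = b ∘ suc
  ; a-injective = suc-injective ∘ a-injective
  ; b-cap = cap (suc-injective ∘ Cap.injective b-cap) (λ i j l → Cap.sum-free b-cap _ _ _)
  ; independent = proj₂ independent }
  where open Config C

injective-∷ : ∀ {k} {A : Set} {f : Fin k → A} {x} → (∀ {i j} → f i ≡ f j → i ≡ j) → (∀ i → x ≢ f i) →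
              ∀ {i j} → (x F.∷ f) i ≡ (x F.∷ f) j → i ≡ j
injective-∷ inj x∉ {zero}  {zero}  eq = refl
injective-∷ inj x∉ {zero}  {suc j} eq = contradiction eq (x∉ j)
injective-∷ inj x∉ {suc i} {zero}  eq = contradiction (sym eq) (x∉ i)
injective-∷ inj x∉ {suc i} {suc j} eq = cong suc (inj eq)

-- Only the new letter involves the new coordinate of `b`, which secures both the cap and
-- independence. Its `a`-part just has to differ from the old ones, hence the bound on `k`.
config-widen : ∀ {k m n} → k < 2 ^ m → Config k m n → Config (suc k) m (suc n)
config-widen {k} {m} {n} k<2ᵐ C = record
  { a = x F.∷ a
  ; b = (true ∷ 𝟎) F.∷ ((false ∷_) ∘ b)
  ; a-injective = injective-∷ a-injective x∉a
  ; b-cap = cap-∷ (cap-false∷ b-cap) (λ ()) (λ i ()) (λ i j ())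
  ; independent =
      -- The unit vector at the new coordinate of `b`.
      ( insert (suc m) true 𝟎
      , trans (·-insert (true ∷ x) 𝟎 true true 𝟎) (cong not (·-zeroʳ ((true ∷ x) ++ 𝟎)))
      , λ s → trans (·-insert (true ∷ a s) (b s) false true 𝟎) (·-zeroʳ ((true ∷ a s) ++ b s)) )
    , independent-embed (λ r → (true ∷ a r) ++ b r) _
        (insert (suc m) false) (λ s u → ·-insert (true ∷ a s) (b s) false false u) independent
  }
  where
  open Config C
  x = proj₁ (fresh k<2ᵐ a)
  x∉a = proj₂ (fresh k<2ᵐ a)

-- Two new letters with b-parts 1 0 and 1 y, the second of which also receives the new coordinate of a.
-- A sum of two b-parts can equal a third one only if y is 𝟎 or one of the old b-parts.
config-enlarge : ∀ {k m n} → k < 2 ^ m → suc k < 2 ^ n → Config k m n → Config (2 + k) (suc m) (suc n)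
config-enlarge {k} {m} {n} k<2ᵐ k<2ⁿ C = record
  { a = (true ∷ 𝟎) F.∷ ((false ∷_) ∘ W.a)
  ; b = (true ∷ y) F.∷ W.b
  ; a-injective = injective-∷ (W.a-injective ∘ ∷-injectiveʳ) (λ i ())
  ; b-cap = cap-∷ W.b-cap (λ ())
      (λ { zero eq → y∉ zero (∷-injectiveʳ eq) ; (suc i) () })
      (λ { zero    zero    ()
         ; zero    (suc j) eq → y∉ (suc j) (trans (∷-injectiveʳ eq) (zipWith-identityˡ Bool.xor-identityˡ _))
         ; (suc i) zero    eq → y∉ (suc i) (trans (∷-injectiveʳ eq) (zipWith-identityʳ Bool.xor-identityʳ _))
         ; (suc i) (suc j) () })
  ; independent =
      -- The unit vector at the new coordinate of `a`, which comes second because of the common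
      -- leading `true`.
      ( false ∷ true ∷ 𝟎
      , cong not (·-zeroʳ (𝟎 {m} ++ (true ∷ y)))
      , λ s → ·-zeroʳ (W.a s ++ W.b s) )
    , independent-embed (λ r → (true ∷ W.a r) ++ W.b r) (λ r → (true ∷ false ∷ W.a r) ++ W.b r)
        (λ { (z ∷ u) → z ∷ false ∷ u }) (λ { s (z ∷ u) → refl }) W.independent
  }
  where
  module W = Config (config-widen k<2ᵐ C)
  y = proj₁ (fresh k<2ⁿ (𝟎 F.∷ Config.b C))
  y∉ = proj₂ (fresh k<2ⁿ (𝟎 F.∷ Config.b C))

config-shrink : ∀ {k m n} j → Config (j + k) m n → Config k m n
config-shrink zero    C = C
config-shrink (suc j) C = config-shrink j (config-tail C)

-- Surplus letters of the starting configuration are dropped first; then each new coordinate of `b`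
-- pays for one letter.
config-grow : ∀ {k₀ m n} d {k} → Config k₀ m n → k ≤ d + k₀ → k ≤ 2 ^ m → Config k m (d + n)
config-grow {k₀} {m} {n} zero {k} C k≤k₀ _ =
  config-shrink (k₀ ∸ k) (subst (λ j → Config j m n) (sym (ℕ.m∸n+n≡m k≤k₀)) C)
config-grow (suc d) {zero}  C _ _ = config-empty
config-grow (suc d) {suc k} C (s≤s k≤d) k<2ᵐ = config-widen k<2ᵐ (config-grow d C k≤d (ℕ.<⇒≤ k<2ᵐ))

-- Two base configurations, certified by evaluation.

bits : ∀ n → ℕ → Bits n
bits zero    x = []
bits (suc n) x = (x % 2 ≡ᵇ 1) ∷ bits n (x / 2)

injective? : ∀ {k n} (a : Fin k → Bits n) → Dec (∀ i j → a i ≡ a j → i ≡ j)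
injective? a = all? λ i → all? λ j → ≡-dec Bool._≟_ (a i) (a j) →-dec (i ≟ j)

sum-free? : ∀ {k n} (b : Fin k → Bits n) → Dec (∀ i j l → b i ≢ b j ⊕ b l)
sum-free? b = all? λ i → all? λ j → all? λ l → ¬? (≡-dec Bool._≟_ (b i) (b j ⊕ b l))

-- The two lists b are the lexicographically first ones for a r = r, with the least significant bit first.
config-7-3-4 : Config 7 3 4
config-7-3-4 = record
  { a = bits 3 ∘ toℕ
  ; b = b
  ; a-injective = from-yes (injective? (bits 3 ∘ toℕ {7})) _ _
  ; b-cap = cap (from-yes (injective? b) _ _) (from-yes (sum-free? b))
  ; independent = from-just (independent? (λ r → (true ∷ bits 3 (toℕ r)) ++ b r))
  }
  where
  b : Fin 7 → Bits 4
  b = bits 4 ∘ lookup (1 ∷ 2 ∷ 4 ∷ 8 ∷ 7 ∷ 13 ∷ 14 ∷ [])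

config-10-4-5 : Config 10 4 5
config-10-4-5 = record
  { a = bits 4 ∘ toℕ
  ; b = b
  ; a-injective = from-yes (injective? (bits 4 ∘ toℕ {10})) _ _
  ; b-cap = cap (from-yes (injective? b) _ _) (from-yes (sum-free? b))
  ; independent = from-just (independent? (λ r → (true ∷ bits 4 (toℕ r)) ++ b r))
  }
  where
  b : Fin 10 → Bits 5
  b = bits 5 ∘ lookup (1 ∷ 2 ∷ 4 ∷ 8 ∷ 7 ∷ 16 ∷ 14 ∷ 27 ∷ 22 ∷ 29 ∷ [])

-- Sums over words and moments of orthogonal arrays.

sumWords : ∀ t → (Word 2 t → ℤ) → ℤ
sumWords zero    f = f []
sumWords (suc t) f = sumWords t (f ∘ (0F ∷_)) ℤ.+ sumWords t (f ∘ (1F ∷_))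

sumWords-cong : ∀ t {f g : Word 2 t → ℤ} → f ≗ g → sumWords t f ≡ sumWords t g
sumWords-cong zero    f≗g = f≗g []
sumWords-cong (suc t) f≗g = cong₂ ℤ._+_ (sumWords-cong t (f≗g ∘ (0F ∷_))) (sumWords-cong t (f≗g ∘ (1F ∷_)))

sumWords-+ : ∀ t (f g : Word 2 t → ℤ) → sumWords t (λ p → f p ℤ.+ g p) ≡ sumWords t f ℤ.+ sumWords t g
sumWords-+ zero    f g = refl
sumWords-+ (suc t) f g =
  trans (cong₂ ℤ._+_ (sumWords-+ t (f ∘ (0F ∷_)) (g ∘ (0F ∷_))) (sumWords-+ t (f ∘ (1F ∷_)) (g ∘ (1F ∷_))))
        (interchange ℤ.+-commutativeSemigroup (sumWords t (f ∘ (0F ∷_))) _ _ _)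

sumWords-* : ∀ t z (f : Word 2 t → ℤ) → sumWords t (λ p → z ℤ.* f p) ≡ z ℤ.* sumWords t f
sumWords-* zero    z f = refl
sumWords-* (suc t) z f =
  trans (cong₂ ℤ._+_ (sumWords-* t z (f ∘ (0F ∷_))) (sumWords-* t z (f ∘ (1F ∷_))))
        (sym (ℤ.*-distribˡ-+ z _ _))

sumWords-0 : ∀ t → sumWords t (const 0ℤ) ≡ 0ℤ
sumWords-0 t = sumWords-* t 0ℤ (const 0ℤ)

indicator : Bool → ℤ
indicator b = if b then 1ℤ else 0ℤ

sumWords-indicator : ∀ {t} (v : Word 2 t) (f : Word 2 t → ℤ) →
                     sumWords t (λ p → indicator (does (≡-dec _≟_ p v)) ℤ.* f p) ≡ f v
sumWords-indicator []       f = ℤ.*-identityˡ (f [])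
sumWords-indicator {suc t} (0F ∷ v) f =
  trans (cong₂ ℤ._+_ (sumWords-indicator v (f ∘ (0F ∷_))) (sumWords-0 t)) (ℤ.+-identityʳ _)
sumWords-indicator {suc t} (1F ∷ v) f =
  trans (cong₂ ℤ._+_ (sumWords-0 t) (sumWords-indicator v (f ∘ (1F ∷_)))) (ℤ.+-identityˡ _)

-- Grouping the rows by their value brings in the multiplicities, about which the balance condition
-- speaks.
sum-by-occurrences : ∀ {t n} (V : Vec (Word 2 t) n) (f : Word 2 t → ℤ) →
                     sum (f ∘ lookup V) ≡ sumWords t (λ p → + occurrences p V ℤ.* f p)
sum-by-occurrences {t} []      f = sym (sumWords-0 t)
sum-by-occurrences {t} (v ∷ V) f = begin
  f v ℤ.+ sum (f ∘ lookup V)  ≡⟨ cong₂ ℤ._+_ (sym (sumWords-indicator v f)) (sum-by-occurrences V f) ⟩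
  sumWords t (λ p → i p ℤ.* f p) ℤ.+ sumWords t (λ p → + occurrences p V ℤ.* f p)  ≡⟨ sym (sumWords-+ t _ _) ⟩
  sumWords t (λ p → i p ℤ.* f p ℤ.+ + occurrences p V ℤ.* f p)  ≡⟨ sumWords-cong t step ⟩
  sumWords t (λ p → + occurrences p (v ∷ V) ℤ.* f p) ∎
  where
  open ≡-Reasoning
  i : Word 2 t → ℤ
  i p = indicator (does (≡-dec _≟_ p v))
  step : ∀ p → i p ℤ.* f p ℤ.+ + occurrences p V ℤ.* f p ≡ + occurrences p (v ∷ V) ℤ.* f p
  step p = trans (sym (ℤ.*-distribʳ-+ (f p) (i p) _)) (cong (ℤ._* f p) (head p))
    where
    head : ∀ p → i p ℤ.+ + occurrences p V ≡ + occurrences p (v ∷ V)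
    head p with does (≡-dec _≟_ p v)
    ... | true  = refl
    ... | false = refl

agreement : Fin 2 → Fin 2 → ℤ
agreement 0F 0F = 1ℤ
agreement 0F 1F = -1ℤ
agreement 1F 0F = -1ℤ
agreement 1F 1F = 1ℤ

agreement-refl : ∀ a → agreement a a ≡ 1ℤ
agreement-refl 0F = refl
agreement-refl 1F = refl

correlation : ∀ {k} → Word 2 k → Word 2 k → ℤ
correlation v w = sum (λ c → agreement (lookup v c) (lookup w c))

third : ∀ {k} → 3 ≤ k → (a b : Fin k) → ∃ λ c → c ≢ a × c ≢ b
third (s≤s (s≤s (s≤s _))) zero          zero          = 1F , (λ ()) , (λ ())
third (s≤s (s≤s (s≤s _))) zero          (suc zero)    = 2F , (λ ()) , (λ ())
third (s≤s (s≤s (s≤s _))) zero          (suc (suc _)) = 1F , (λ ()) , (λ ())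
third (s≤s (s≤s (s≤s _))) (suc zero)    zero          = 2F , (λ ()) , (λ ())
third (s≤s (s≤s (s≤s _))) (suc (suc _)) zero          = 1F , (λ ()) , (λ ())
third (s≤s (s≤s (s≤s _))) (suc _)       (suc _)       = 0F , (λ ()) , (λ ())

triple : ∀ {k} {a b c : Fin k} → b ≢ a → c ≢ a → c ≢ b → Fin 3 ↣ Fin k
triple {k} {a} {b} {c} b≢a c≢a c≢b = mk↣ {to = to} injective
  where
  to : Fin 3 → Fin k
  to = lookup (a ∷ b ∷ c ∷ [])
  injective : ∀ {i j} → to i ≡ to j → i ≡ j
  injective {0F} {0F} _  = refl
  injective {0F} {1F} eq = contradiction (sym eq) b≢a
  injective {0F} {2F} eq = contradiction (sym eq) c≢a
  injective {1F} {0F} eq = contradiction eq b≢a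
  injective {1F} {1F} _  = refl
  injective {1F} {2F} eq = contradiction (sym eq) c≢b
  injective {2F} {0F} eq = contradiction eq c≢a
  injective {2F} {1F} eq = contradiction eq c≢b
  injective {2F} {2F} _  = refl

-- Strength 3 speaks of three distinct columns only, so coinciding columns are padded to a triple.
cover : ∀ {k} → 3 ≤ k → (a b c : Fin k) → ∃ λ (t : Fin 3 ↣ Fin k) → let open Injection t in
        to 0F ≡ a × (∃ λ p → to p ≡ b) × (∃ λ q → to q ≡ c)
cover 3≤k a b c with b ≟ a | c ≟ a | c ≟ b
... | no  b≢a  | no  c≢a  | no c≢b   = triple b≢a c≢a c≢b , refl , (1F , refl) , (2F , refl)
... | no  b≢a  | no  c≢a  | yes refl =
  let d , d≢a , d≢b = third 3≤k a b in triple b≢a d≢a d≢b , refl , (1F , refl) , (1F , refl)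
... | no  b≢a  | yes refl | _        =
  let d , d≢a , d≢b = third 3≤k a b in triple b≢a d≢a d≢b , refl , (1F , refl) , (0F , refl)
... | yes refl | no  c≢a  | _        =
  let d , d≢a , d≢c = third 3≤k a c in triple c≢a d≢a d≢c , refl , (0F , refl) , (1F , refl)
... | yes refl | yes refl | _        =
  let d , d≢a , _   = third 3≤k a a
      e , e≢a , e≢d = third 3≤k a d
  in triple d≢a e≢a e≢d , refl , (0F , refl) , (0F , refl)

sum-const : ∀ n z → sum {n} (const z) ≡ + n ℤ.* z
sum-const zero    z = refl
sum-const (suc n) z = trans (cong (λ s → z ℤ.+ s) (sum-const n z)) (sym (ℤ.suc-* (+ n) z))

sum-indicator : ∀ {k} (c : Fin k) z → sum (λ c′ → indicator (does (c ≟ c′)) ℤ.* z) ≡ z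
sum-indicator {suc k} zero    z = trans (cong₂ ℤ._+_ (ℤ.*-identityˡ z) (sum-replicate-zero k)) (ℤ.+-identityʳ z)
sum-indicator {suc k} (suc c) z = trans (ℤ.+-identityˡ _) (sum-indicator c z)

sum-nonneg : ∀ {n} (f : Fin n → ℤ) → (∀ i → 0ℤ ℤ.≤ f i) → 0ℤ ℤ.≤ sum f
sum-nonneg {zero}  f f≥0 = ℤ.≤-refl
sum-nonneg {suc n} f f≥0 = ℤ.+-mono-≤ (f≥0 zero) (sum-nonneg (f ∘ suc) (f≥0 ∘ suc))

term≤sum : ∀ {n} (f : Fin n → ℤ) → (∀ i → 0ℤ ℤ.≤ f i) → ∀ i → f i ℤ.≤ sum f
term≤sum {suc n} f f≥0 i = begin
  f i                               ≡⟨ sym (ℤ.+-identityʳ _) ⟩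
  f i ℤ.+ 0ℤ                        ≤⟨ ℤ.+-monoʳ-≤ (f i) (sum-nonneg (F.removeAt f i) (f≥0 ∘ punchIn i)) ⟩
  f i ℤ.+ sum (F.removeAt f i)      ≡⟨ sym (sum-remove {i = i} f) ⟩
  sum f                             ∎
  where open ℤ.≤-Reasoning

two-terms≤sum : ∀ {n} (f : Fin n → ℤ) → (∀ i → 0ℤ ℤ.≤ f i) → ∀ {i j} → i ≢ j → f i ℤ.+ f j ℤ.≤ sum f
two-terms≤sum {suc n} f f≥0 {i} {j} i≢j = begin
  f i ℤ.+ f j                             ≡⟨ cong (λ j′ → f i ℤ.+ f j′) (sym (punchIn-punchOut i≢j)) ⟩
  f i ℤ.+ F.removeAt f i (punchOut i≢j)   ≤⟨ ℤ.+-monoʳ-≤ (f i) (term≤sum (F.removeAt f i) (f≥0 ∘ punchIn i) _) ⟩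
  f i ℤ.+ sum (F.removeAt f i)            ≡⟨ sym (sum-remove {i = i} f) ⟩
  sum f                                   ∎
  where open ℤ.≤-Reasoning

square≥0 : ∀ z → 0ℤ ℤ.≤ z ℤ.* z
square≥0 (+ n)    = subst (0ℤ ℤ.≤_) (ℤ.pos-* n n) (+≤+ z≤n)
square≥0 -[1+ n ] = +≤+ z≤n

local-moment : Word 2 3 → Fin 3 → Fin 3 → Word 2 3 → ℤ
local-moment a p q w = (1ℤ ℤ.+ s 0F) ℤ.* (s p ℤ.* s q)
  where
  s : Fin 3 → ℤ
  s r = agreement (lookup a r) (lookup w r)

-- Expanding the factor `1 + s 0` gives a product of two signs and a product of three. The latter
-- has odd degree in some sign and sums to zero; the former sums to 8 if `p` and `q` coincide and to
-- zero otherwise. The finitely many cases are evaluated.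
sum-local-moment : ∀ a p q → sumWords 3 (local-moment a p q) ≡ + 8 ℤ.* indicator (does (p ≟ q))
sum-local-moment (a ∷ b ∷ c ∷ []) = from-yes (all? λ a → all? λ b → all? λ c → all? λ p → all? λ q →
  sumWords 3 (local-moment (a ∷ b ∷ c ∷ []) p q) ℤ.≟ + 8 ℤ.* indicator (does (p ≟ q))) a b c

module _ {k n} {A : Vec (Word 2 k) n} (oa : IsOA n k 2 3 A) (x : Word 2 k) where

  open IsOA oa renaming (t≤k to 3≤k)

  χ : Fin n → Fin k → ℤ
  χ j c = agreement (lookup x c) (lookup (lookup A j) c)

  T : Fin n → ℤ
  T j = correlation x (lookup A j)

  pair-moment : ∀ c₀ c c′ → sum (λ j → (1ℤ ℤ.+ χ j c₀) ℤ.* (χ j c ℤ.* χ j c′)) ≡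
                indicator (does (c ≟ c′)) ℤ.* + n
  pair-moment c₀ c c′ with cover 3≤k c₀ c c′
  -- The balance condition fixes multiplicities only after multiplication by 8, so both sides are
  -- compared in that form.
  ... | t , refl , (p , refl) , (q , refl) = ℤ.*-cancelʳ-≡ _ _ (+ 8) (begin
    sum (λ j → (1ℤ ℤ.+ χ j (to 0F)) ℤ.* (χ j (to p) ℤ.* χ j (to q))) ℤ.* + 8
      ≡⟨ cong (ℤ._* + 8) (sum-cong-≗ local) ⟩
    sum (f ∘ lookup (map (select t) A)) ℤ.* + 8
      ≡⟨ cong (ℤ._* + 8) (sum-by-occurrences (map (select t) A) f) ⟩
    sumWords 3 (λ w → + occ w ℤ.* f w) ℤ.* + 8
      ≡⟨ trans (ℤ.*-comm (sumWords 3 (λ w → + occ w ℤ.* f w)) (+ 8)) (sym (sumWords-* 3 (+ 8) (λ w → + occ w ℤ.* f w))) ⟩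
    sumWords 3 (λ w → + 8 ℤ.* (+ occ w ℤ.* f w))
      ≡⟨ sumWords-cong 3 (λ w → trans (rearrange (+ occ w) (f w))
           (cong (ℤ._* f w) (trans (sym (ℤ.pos-* (occ w) 8)) (cong +_ (balanced t w))))) ⟩
    sumWords 3 (λ w → + n ℤ.* f w)
      ≡⟨ sumWords-* 3 (+ n) f ⟩
    + n ℤ.* sumWords 3 f
      ≡⟨ cong (+ n ℤ.*_) (sum-local-moment (select t x) p q) ⟩
    + n ℤ.* (+ 8 ℤ.* indicator (does (p ≟ q)))
      ≡⟨ cong (λ b → + n ℤ.* (+ 8 ℤ.* indicator b)) same ⟩
    + n ℤ.* (+ 8 ℤ.* indicator (does (to p ≟ to q)))
      ≡⟨ rearrange′ (+ n) (indicator (does (to p ≟ to q))) ⟩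
    indicator (does (to p ≟ to q)) ℤ.* + n ℤ.* + 8 ∎)
    where
    open ≡-Reasoning
    open Injection t using (to; injective)
    f = local-moment (select t x) p q
    occ : Word 2 3 → ℕ
    occ w = occurrences w (map (select t) A)
    rearrange : ∀ y z → + 8 ℤ.* (y ℤ.* z) ≡ y ℤ.* + 8 ℤ.* z
    rearrange = solve-∀
    rearrange′ : ∀ y z → y ℤ.* (+ 8 ℤ.* z) ≡ z ℤ.* y ℤ.* + 8
    rearrange′ = solve-∀
    same : does (p ≟ q) ≡ does (to p ≟ to q)
    same with p ≟ q
    ... | yes refl = sym (dec-true (to p ≟ to p) refl)
    ... | no  p≢q  = sym (dec-false (to p ≟ to q) (p≢q ∘ injective))
    entry : ∀ j r → agreement (lookup (select t x) r) (lookup (lookup (map (select t) A) j) r) ≡ χ j (to r)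
    entry j r rewrite lookup-map j (select t) A =
      cong₂ agreement (lookup∘tabulate (lookup x ∘ to) r) (lookup∘tabulate (lookup (lookup A j) ∘ to) r)
    local : ∀ j → (1ℤ ℤ.+ χ j (to 0F)) ℤ.* (χ j (to p) ℤ.* χ j (to q)) ≡ f (lookup (map (select t) A) j)
    local j = sym (cong₂ (λ u v → (1ℤ ℤ.+ u) ℤ.* v) (entry j 0F) (cong₂ ℤ._*_ (entry j p) (entry j q)))

  -- Expanding the square gives a double sum over columns, of which `pair-moment` leaves only the
  -- `k` diagonal terms.
  square-moment : ∀ c₀ → sum (λ j → (1ℤ ℤ.+ χ j c₀) ℤ.* (T j ℤ.* T j)) ≡ + k ℤ.* + n
  square-moment c₀ = begin
    sum (λ j → (1ℤ ℤ.+ χ j c₀) ℤ.* (T j ℤ.* T j))                        ≡⟨ sum-cong-≗ expand ⟩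
    sum (λ j → sum (λ c → sum (λ c′ → m j c c′)))                          ≡⟨ ∑-comm (λ j c → sum (m j c)) ⟩
    sum (λ c → sum (λ j → sum (λ c′ → m j c c′)))                          ≡⟨ sum-cong-≗ (λ c → ∑-comm (λ j c′ → m j c c′)) ⟩
    sum (λ c → sum (λ c′ → sum (λ j → m j c c′)))                          ≡⟨ sum-cong-≗ (λ c → sum-cong-≗ (pair-moment c₀ c)) ⟩
    sum (λ (c : Fin k) → sum (λ c′ → indicator (does (c ≟ c′)) ℤ.* + n))  ≡⟨ sum-cong-≗ {k} (λ c → sum-indicator c (+ n)) ⟩
    sum {k} (const (+ n))                                                  ≡⟨ sum-const k (+ n) ⟩
    + k ℤ.* + n                                                            ∎
    where
    open ≡-Reasoning
    m : Fin n → Fin k → Fin k → ℤ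
    m j c c′ = (1ℤ ℤ.+ χ j c₀) ℤ.* (χ j c ℤ.* χ j c′)
    expand : ∀ j → (1ℤ ℤ.+ χ j c₀) ℤ.* (T j ℤ.* T j) ≡ sum (λ c → sum (m j c))
    expand j = begin
      w ℤ.* (T j ℤ.* T j)                            ≡⟨ cong (w ℤ.*_) (*-distribʳ-sum (T j) (χ j)) ⟩
      w ℤ.* sum (λ c → χ j c ℤ.* T j)                ≡⟨ *-distribˡ-sum w (λ c → χ j c ℤ.* T j) ⟩
      sum (λ c → w ℤ.* (χ j c ℤ.* T j))              ≡⟨ sum-cong-≗ (λ c → cong (w ℤ.*_) (*-distribˡ-sum (χ j c) (χ j))) ⟩
      sum (λ c → w ℤ.* sum (λ c′ → χ j c ℤ.* χ j c′)) ≡⟨ sum-cong-≗ (λ c → *-distribˡ-sum w (λ c′ → χ j c ℤ.* χ j c′)) ⟩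
      sum (λ c → sum (m j c))                        ∎
      where w = 1ℤ ℤ.+ χ j c₀

-- The bound `2 * k ≤ n` and the case of equality.

*-nonneg : ∀ {y z} → 0ℤ ℤ.≤ y → 0ℤ ℤ.≤ z → 0ℤ ℤ.≤ y ℤ.* z
*-nonneg {+ m} {+ n} _ _ = subst (0ℤ ℤ.≤_) (ℤ.pos-* m n) (+≤+ z≤n)

1+agreement≥0 : ∀ a b → 0ℤ ℤ.≤ 1ℤ ℤ.+ agreement a b
1+agreement≥0 0F 0F = +≤+ z≤n
1+agreement≥0 0F 1F = +≤+ z≤n
1+agreement≥0 1F 0F = +≤+ z≤n
1+agreement≥0 1F 1F = +≤+ z≤n

1+agreement≡0 : ∀ a b → 1ℤ ℤ.+ agreement a b ≡ 0ℤ → agreement a b ≡ -1ℤ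
1+agreement≡0 0F 0F ()
1+agreement≡0 0F 1F _ = refl
1+agreement≡0 1F 0F _ = refl
1+agreement≡0 1F 1F ()

module _ {k n} {A : Vec (Word 2 k) n} (oa : IsOA n k 2 3 A) (i : Fin n) where

  private
    χᵢ = χ oa (lookup A i)
    Tᵢ = T oa (lookup A i)

  φ : Fin k → Fin n → ℤ
  φ c j = (1ℤ ℤ.+ χᵢ j c) ℤ.* (Tᵢ j ℤ.* Tᵢ j)

  φ≥0 : ∀ c j → 0ℤ ℤ.≤ φ c j
  φ≥0 c j = *-nonneg (1+agreement≥0 (lookup (lookup A i) c) (lookup (lookup A j) c)) (square≥0 (Tᵢ j))

  φ-self : ∀ c → φ c i ≡ + k ℤ.* + (2 * k)
  φ-self c = begin
    (1ℤ ℤ.+ χᵢ i c) ℤ.* (Tᵢ i ℤ.* Tᵢ i)  ≡⟨ cong₂ (λ u v → (1ℤ ℤ.+ u) ℤ.* (v ℤ.* v)) (agreement-refl (lookup (lookup A i) c)) Tᵢi≡k ⟩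
    + 2 ℤ.* (+ k ℤ.* + k)                 ≡⟨ rearrange (+ k) ⟩
    + k ℤ.* (+ 2 ℤ.* + k)                 ≡⟨ cong (+ k ℤ.*_) (sym (ℤ.pos-* 2 k)) ⟩
    + k ℤ.* + (2 * k)                     ∎
    where
    open ≡-Reasoning
    Tᵢi≡k : Tᵢ i ≡ + k
    Tᵢi≡k = trans (sum-cong-≗ (λ c → agreement-refl (lookup (lookup A i) c))) (trans (sum-const k 1ℤ) (ℤ.*-identityʳ (+ k)))
    rearrange : ∀ y → + 2 ℤ.* (y ℤ.* y) ≡ y ℤ.* (+ 2 ℤ.* y)
    rearrange = solve-∀

  -- All terms are nonnegative, and the one of row `i` already exhausts the total `k * n`.
  tight⇒φ≡0 : n ≡ 2 * k → ∀ {j} → i ≢ j → ∀ c → φ c j ≡ 0ℤ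
  tight⇒φ≡0 n≡2k {j} i≢j c = ℤ.≤-antisym (ℤ.≮⇒≥ (λ 0<φ → ℤ.<⇒≱ (ℤ.+-monoʳ-< (φ c i) 0<φ) (begin
    φ c i ℤ.+ φ c j     ≤⟨ two-terms≤sum (φ c) (φ≥0 c) i≢j ⟩
    sum (φ c)           ≡⟨ square-moment oa (lookup A i) c ⟩
    + k ℤ.* + n         ≡⟨ cong (λ z → + k ℤ.* + z) n≡2k ⟩
    + k ℤ.* + (2 * k)   ≡⟨ sym (φ-self c) ⟩
    φ c i               ≡⟨ sym (ℤ.+-identityʳ (φ c i)) ⟩
    φ c i ℤ.+ 0ℤ        ∎))) (φ≥0 c j)
    where open ℤ.≤-Reasoning

  tight⇒orthogonal-or-opposite : n ≡ 2 * k → ∀ {j} → i ≢ j → Tᵢ j ≡ 0ℤ ⊎ Tᵢ j ≡ + k ℤ.* -1ℤ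
  tight⇒orthogonal-or-opposite n≡2k {j} i≢j with Tᵢ j ℤ.≟ 0ℤ
  ... | yes T≡0 = inj₁ T≡0
  ... | no  T≢0 = inj₂ (trans (sum-cong-≗ opposite) (sum-const k -1ℤ))
    where
    -- The column carrying the weight is arbitrary: as the square is nonzero, the weight vanishes in
    -- every column.
    opposite : ∀ c → χᵢ j c ≡ -1ℤ
    opposite c with ℤ.i*j≡0⇒i≡0∨j≡0 (1ℤ ℤ.+ χᵢ j c) (tight⇒φ≡0 n≡2k i≢j c)
    ... | inj₁ 1+χ≡0 = 1+agreement≡0 _ _ 1+χ≡0
    ... | inj₂ TT≡0  = contradiction (reduce (ℤ.i*j≡0⇒i≡0∨j≡0 (Tᵢ j) TT≡0)) T≢0

-- This is Rao's bound for two levels and strength 3. The case of no columns is separate, since the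
-- argument needs a column to carry the weight and cancels `k`.
OA⇒2k≤n : ∀ {k n} {A : Vec (Word 2 k) n} → IsOA n k 2 3 A → Fin n → 2 * k ≤ n
OA⇒2k≤n {zero}  oa i = z≤n
OA⇒2k≤n {k@(suc _)} {n} {A} oa i = ℕ.*-cancelˡ-≤ k (ℤ.drop‿+≤+ (begin
  + (k * (2 * k))      ≡⟨ ℤ.pos-* k (2 * k) ⟩
  + k ℤ.* + (2 * k)    ≡⟨ sym (φ-self oa i zero) ⟩
  φ oa i zero i        ≤⟨ term≤sum (φ oa i zero) (φ≥0 oa i zero) i ⟩
  sum (φ oa i zero)    ≡⟨ square-moment oa (lookup A i) zero ⟩
  + k ℤ.* + n          ≡⟨ sym (ℤ.pos-* k n) ⟩
  + (k * n)            ∎))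
  where open ℤ.≤-Reasoning

-- Parity of weights.

odd : ℕ → Bool
odd zero    = false
odd (suc n) = not (odd n)

odd-+ : ∀ m n → odd (m + n) ≡ odd m xor odd n
odd-+ zero    n = refl
odd-+ (suc m) n = trans (cong not (odd-+ m n)) (Bool.not-distribˡ-xor (odd m) (odd n))

odd-double : ∀ n → odd (n + n) ≡ false
odd-double n = trans (odd-+ n n) (Bool.xor-same (odd n))

weight : ∀ {k} → Word 2 k → ℕ
weight []       = 0
weight (0F ∷ w) = weight w
weight (1F ∷ w) = suc (weight w)

distance : ∀ {k} → Word 2 k → Word 2 k → ℕ
distance []       []       = 0
distance (0F ∷ v) (0F ∷ w) = distance v w
distance (0F ∷ v) (1F ∷ w) = suc (distance v w)
distance (1F ∷ v) (0F ∷ w) = suc (distance v w)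
distance (1F ∷ v) (1F ∷ w) = distance v w

odd-distance : ∀ {k} (v w : Word 2 k) → odd (weight w) ≡ odd (distance v w) xor odd (weight v)
odd-distance []       []       = refl
odd-distance (0F ∷ v) (0F ∷ w) = odd-distance v w
odd-distance (0F ∷ v) (1F ∷ w) = trans (cong not (odd-distance v w)) (Bool.not-distribˡ-xor (odd (distance v w)) _)
odd-distance (1F ∷ v) (0F ∷ w) = trans (odd-distance v w) (sym (Bool.xor-annihilates-not (odd (distance v w)) _))
odd-distance (1F ∷ v) (1F ∷ w) = trans (cong not (odd-distance v w)) (Bool.not-distribʳ-xor (odd (distance v w)) _)

correlation-distance : ∀ {k} (v w : Word 2 k) → correlation v w ℤ.+ + (distance v w + distance v w) ≡ + k
correlation-distance []      []      = refl
correlation-distance (a ∷ v) (b ∷ w) = step a b (correlation-distance v w)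
  where
  agree : ∀ t d → 1ℤ ℤ.+ t ℤ.+ d ≡ 1ℤ ℤ.+ (t ℤ.+ d)
  agree = solve-∀
  disagree : ∀ t d → -1ℤ ℤ.+ t ℤ.+ (1ℤ ℤ.+ d ℤ.+ (1ℤ ℤ.+ d)) ≡ 1ℤ ℤ.+ (t ℤ.+ (d ℤ.+ d))
  disagree = solve-∀
  step : ∀ a b {l} → correlation v w ℤ.+ + (distance v w + distance v w) ≡ + l →
         correlation (a ∷ v) (b ∷ w) ℤ.+ + (distance (a ∷ v) (b ∷ w) + distance (a ∷ v) (b ∷ w)) ≡ + suc l
  step 0F 0F eq = trans (agree (correlation v w) (+ (distance v w + distance v w))) (cong ℤ.suc eq)
  step 0F 1F eq = trans (disagree (correlation v w) (+ distance v w)) (cong ℤ.suc eq)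
  step 1F 0F eq = trans (disagree (correlation v w) (+ distance v w)) (cong ℤ.suc eq)
  step 1F 1F eq = trans (agree (correlation v w) (+ (distance v w + distance v w))) (cong ℤ.suc eq)

double-injective : ∀ m n → m + m ≡ n + n → m ≡ n
double-injective m n eq = ℕ.*-cancelˡ-≡ m n 2 (trans (cong (λ z → m + z) (ℕ.+-identityʳ m)) (trans eq (cong (λ z → n + z) (sym (ℕ.+-identityʳ n)))))

-- Correlation 0 means distance `k / 2`, which is `q + q`, and correlation `- k` means distance `k`.
-- Both are even, and the distance has the parity of the sum of the two weights.
tight⇒same-parity : ∀ {k n q} {A : Vec (Word 2 k) n} → IsOA n k 2 3 A → n ≡ 2 * k → k ≡ (q + q) + (q + q) →
                    ∀ i j → odd (weight (lookup A j)) ≡ odd (weight (lookup A i))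
tight⇒same-parity {k} {n} {q} {A} oa n≡2k k≡4q i j with i ≟ j
... | yes refl = refl
... | no  i≢j  = trans (odd-distance (lookup A i) (lookup A j)) (cong (_xor odd (weight (lookup A i))) even)
  where
  d = distance (lookup A i) (lookup A j)
  corr = correlation-distance (lookup A i) (lookup A j)
  even : odd d ≡ false
  even with tight⇒orthogonal-or-opposite oa i n≡2k i≢j
  ... | inj₁ T≡0  = trans (cong odd (double-injective d (q + q) (trans
    (ℤ.+-injective (trans (sym (ℤ.+-identityˡ _)) (trans (cong (ℤ._+ + (d + d)) (sym T≡0)) corr))) k≡4q))) (odd-double q)
  ... | inj₂ T≡-k = trans (cong odd (trans (double-injective d k (ℤ.+-injective (move (+ k) _
    (trans (cong (ℤ._+ + (d + d)) (sym T≡-k)) corr)))) k≡4q)) (odd-double (q + q))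
    where
    move : ∀ y z → y ℤ.* -1ℤ ℤ.+ z ≡ y → z ≡ y ℤ.+ y
    move y z eq = trans (identity y z) (cong (ℤ._+ y) eq)
      where
      identity : ∀ y z → z ≡ y ℤ.* -1ℤ ℤ.+ z ℤ.+ y
      identity = solve-∀

-- Necessary conditions on the parameters.

module _ {A : Set} {P : A → Set} (P? : ∀ x → Dec (P x)) where

  count≢0⇒∃ : ∀ {n} (v : Vec A n) → count P? v ≢ 0 → ∃ λ i → P (lookup v i)
  count≢0⇒∃ []      ≢0 = contradiction refl ≢0
  count≢0⇒∃ (x ∷ v) ≢0 with P? x
  ... | yes px = zero , px
  ... | no  _  = let i , pi = count≢0⇒∃ v ≢0 in suc i , pi

  count-concat≢0⇒∃ : ∀ {m n} (G : Grid A m n) → count P? (concat G) ≢ 0 → ∃₂ λ i j → P (lookup (row G i) j)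
  count-concat≢0⇒∃ []      ≢0 = contradiction refl ≢0
  count-concat≢0⇒∃ (r ∷ G) ≢0 with count P? r ℕ.≟ 0
  ... | no  r≢0 = let j , pj = count≢0⇒∃ r r≢0 in zero , j , pj
  ... | yes r≡0 =
    let i , j , pij = count-concat≢0⇒∃ G (λ G≡0 → ≢0 (trans (count-++ P? r (concat G)) (cong₂ _+_ r≡0 G≡0)))
    in suc i , j , pij

word-occurs : ∀ {k m n t G} → IsFactorialDesign k m n 2 t G → m * n ≢ 0 → ∀ w → occurrences w (concat G) ≢ 0
word-occurs {k} D mn≢0 w occ≡0 = mn≢0 (trans (sym (IsFactorialDesign.cells D w)) (cong (_* 2 ^ k) occ≡0))

weight-zeros : ∀ k → weight (replicate k 0F) ≡ 0
weight-zeros zero    = refl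
weight-zeros (suc k) = weight-zeros k

-- With equal sides, rows and columns are all tight, so the parity is constant on the whole grid.
-- Yet every word occurs, including words of weight 0 and 1.
no-tight-square : ∀ {k n q} → n ≡ 2 * suc k → suc k ≡ (q + q) + (q + q) → ¬ ExistsI (suc k) n n 2 3
no-tight-square {k} {n@(suc _)} {q} n≡2k k≡4q (G , D) =
  let i₀ , j₀ , w₀≡ = somewhere w₀
      i₁ , j₁ , w₁≡ = somewhere w₁
  in contradiction (begin
    false                              ≡⟨ cong odd (sym (weight-zeros k)) ⟩
    odd (weight w₀)                    ≡⟨ cong (odd ∘ weight) w₀≡ ⟩
    -- The two cells are joined through the cell in row `i₀` and column `j₁`.
    parity i₀ j₀                       ≡⟨ tight⇒same-parity {q = q} (rows-OA i₀) n≡2k k≡4q j₁ j₀ ⟩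
    parity i₀ j₁                       ≡⟨ cong (odd ∘ weight) (sym (lookup-map i₀ (λ r → lookup r j₁) G)) ⟩
    odd (weight (lookup (column G j₁) i₀)) ≡⟨ tight⇒same-parity {q = q} (columns-OA j₁) n≡2k k≡4q i₁ i₀ ⟩
    odd (weight (lookup (column G j₁) i₁)) ≡⟨ cong (odd ∘ weight) (lookup-map i₁ (λ r → lookup r j₁) G) ⟩
    parity i₁ j₁                       ≡⟨ cong (odd ∘ weight) (sym w₁≡) ⟩
    odd (weight w₁)                    ≡⟨ cong (odd ∘ suc) (weight-zeros k) ⟩
    true                               ∎) (λ ())
  where
  open ≡-Reasoning
  open IsFactorialDesign D
  parity : Fin n → Fin n → Bool
  parity i j = odd (weight (lookup (row G i) j))
  w₀ w₁ : Word 2 (suc k)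
  w₀ = 0F ∷ replicate k 0F
  w₁ = 1F ∷ replicate k 0F
  somewhere : ∀ w → ∃₂ λ i j → w ≡ lookup (row G i) j
  somewhere w = count-concat≢0⇒∃ (≡-dec _≟_ w) G (word-occurs D (λ ()) w)

index : ∀ m → Fin (2 ^ m)
index m = fromℕ< (ℕ.m^n>0 2 m)

3≤2^m⇒3≤1+m : ∀ m → 3 ≤ 2 ^ m → 3 ≤ suc m
3≤2^m⇒3≤1+m 0             (s≤s ())
3≤2^m⇒3≤1+m 1             (s≤s (s≤s ()))
3≤2^m⇒3≤1+m (suc (suc _)) _ = s≤s (s≤s (s≤s z≤n))

module _ {k} m N (E : ExistsI k (2 ^ suc m) (2 ^ N) 2 3) where

  private
    G = proj₁ E
    D = proj₂ E
  open IsFactorialDesign D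

  k≤2^m : k ≤ 2 ^ m
  k≤2^m = ℕ.*-cancelˡ-≤ 2 (OA⇒2k≤n (columns-OA (index N)) (index (suc m)))

  -- The zero word occurs at least once, so `2 ^ k` is at most the number of cells.
  k≤M+N : k ≤ suc m + N
  k≤M+N = ℕ.≮⇒≥ λ M+N<k → ℕ.<⇒≱ (ℕ.^-monoʳ-< 2 (s≤s (s≤s z≤n)) M+N<k) (begin
    2 ^ k                                  ≡⟨ sym (ℕ.*-identityˡ (2 ^ k)) ⟩
    1 * 2 ^ k                              ≤⟨ ℕ.*-monoˡ-≤ (2 ^ k) (ℕ.n≢0⇒n>0 (word-occurs D (ℕ.m<n⇒n≢0 (ℕ.*-mono-≤ (ℕ.m^n>0 2 (suc m)) (ℕ.m^n>0 2 N))) w)) ⟩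
    occurrences w (concat G) * 2 ^ k       ≡⟨ cells w ⟩
    2 ^ suc m * 2 ^ N                      ≡⟨ sym (ℕ.^-distribˡ-+-* 2 (suc m) N) ⟩
    2 ^ (suc m + N)                        ∎)
    where
    open ℕ.≤-Reasoning
    w = replicate k 0F

-- Configurations for all admissible parameters.

config-at : ∀ {k₀ m n₀ k n} → Config k₀ m n₀ → n₀ ≤ n → k ≤ (n ∸ n₀) + k₀ → k ≤ 2 ^ m → Config k m n
config-at {n₀ = n₀} {k} {n} C n₀≤n k≤ k≤2ᵐ =
  subst (Config k _) (ℕ.m∸n+n≡m n₀≤n) (config-grow (n ∸ n₀) C k≤ k≤2ᵐ)

-- One inequality serves both size conditions of `config-enlarge`. It persists because the left side
-- grows by 2 while the right side doubles.
diagonal-bound : ∀ d → suc (d + (d + 10)) < 2 ^ (4 + d)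
diagonal-bound zero    = ℕ.m≤m+n 12 4
diagonal-bound (suc d) = begin-strict
  suc (suc d + (suc d + 10))                        ≡⟨ cong (λ z → suc (suc z)) (ℕ.+-suc d (d + 10)) ⟩
  2 + suc (d + (d + 10))                            <⟨ ℕ.+-mono-≤-< (ℕ.^-monoʳ-≤ 2 {1} {4 + d} (s≤s z≤n)) (diagonal-bound d) ⟩
  2 ^ (4 + d) + 2 ^ (4 + d)                         ≡⟨ cong (λ z → 2 ^ (4 + d) + z) (sym (ℕ.+-identityʳ _)) ⟩
  2 ^ (5 + d)                                       ∎
  where open ℕ.≤-Reasoning

-- With `M = N = 5 + d` the number of letters is `M + N`, the largest possible; an enlargement
-- raises both by 2.
config-diagonal : ∀ d → Config (d + (d + 10)) (4 + d) (5 + d)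
config-diagonal zero    = config-10-4-5
config-diagonal (suc d) = subst (λ k → Config k (5 + d) (6 + d)) (cong suc (sym (ℕ.+-suc d (d + 10))))
  (config-enlarge (ℕ.<⇒≤ (diagonal-bound d)) (ℕ.≤-trans (diagonal-bound d) (ℕ.m≤m+n _ _)) (config-diagonal d))

config-exists : ∀ {k m N} → k ≤ suc m + N → 3 ≤ suc m → suc m ≤ N → k ≤ 2 ^ m →
                _∉_ {A = ℕ × ℕ × ℕ} (k , suc m , N) ((4 , 3 , 3) ∷ (8 , 4 , 4) ∷ []) → Config k m N
config-exists {m = 0} _ (s≤s ())       _ _ _
config-exists {m = 1} _ (s≤s (s≤s ())) _ _ _
config-exists {k} {2} {1} _ _ (s≤s ()) _ _
config-exists {k} {2} {2} _ _ (s≤s (s≤s ())) _ _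
-- Three coordinates of `b` yield three letters from nothing, and the fourth is the excluded case.
config-exists {k} {2} {3} _ _ _ k≤4 ∉ = config-at config-empty z≤n (ℕ.≤-pred (ℕ.≤∧≢⇒< k≤4 λ { refl → ∉ (here refl) })) k≤4
config-exists {k} {2} {suc (suc (suc (suc N)))} _ _ _ k≤4 _ =
  config-at config-empty z≤n (ℕ.≤-trans k≤4 (s≤s (s≤s (s≤s (s≤s z≤n))))) k≤4
config-exists {k} {3} {1} _ _ (s≤s ()) _ _
config-exists {k} {3} {2} _ _ (s≤s (s≤s ())) _ _
config-exists {k} {3} {3} _ _ (s≤s (s≤s (s≤s ()))) _ _
config-exists {k} {3} {4} _ _ _ k≤8 ∉ =
  config-at config-7-3-4 ℕ.≤-refl (ℕ.≤-pred (ℕ.≤∧≢⇒< k≤8 λ { refl → ∉ (there (here refl)) })) k≤8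
config-exists {k} {3} {suc (suc (suc (suc (suc N))))} _ _ _ k≤8 _ =
  -- At least one coordinate beyond the fourth is available, and it pays for the eighth letter.
  config-at config-7-3-4 (ℕ.m≤m+n 4 (suc N)) (ℕ.≤-trans k≤8 (ℕ.≤-trans (ℕ.m≤n+m 8 N) (ℕ.≤-reflexive (ℕ.+-suc N 7)))) k≤8
-- The diagonal supplies `2 * M` letters, and the remaining `N ∸ M` coordinates raise this to
-- `M + N`.
config-exists {k} {suc (suc (suc (suc d)))} {N} k≤M+N _ M≤N k≤2ᵐ _ = config-at (config-diagonal d) M≤N (begin
  k                                       ≤⟨ k≤M+N ⟩
  5 + d + N                               ≡⟨ ℕ.+-comm (5 + d) N ⟩
  N + (5 + d)                             ≡⟨ cong (_+ (5 + d)) (sym (ℕ.m∸n+n≡m M≤N)) ⟩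
  N ∸ (5 + d) + (5 + d) + (5 + d)         ≡⟨ ℕ.+-assoc (N ∸ (5 + d)) _ _ ⟩
  N ∸ (5 + d) + (5 + d + (5 + d))         ≡⟨ cong (λ z → N ∸ (5 + d) + z) (rearrange d) ⟩
  N ∸ (5 + d) + (d + (d + 10))            ∎) k≤2ᵐ
  where
  open ℕ.≤-Reasoning
  rearrange : ∀ d → 5 + d + (5 + d) ≡ d + (d + 10)
  rearrange = solve-∀-ℕ

config-design : ∀ {k m n} → 3 ≤ k → Config k m n → ExistsI k (2 ^ suc m) (2 ^ n) 2 3
config-design 3≤k C = linear-design ((true ∷_) ∘ a) b 3≤k (cap-true∷ a-injective) b-cap independent
  where open Config C

theorem10 : ∀ (k M N : ℕ) → 1 ≤ M → M ≤ N → 1 ≤ k →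
    ExistsI k (2 ^ M) (2 ^ N) 2 3 ⇔
    (3 ≤ k × k ≤ M + N × 3 ≤ M × k ≤ 2 ^ (M ∸ 1) ×
    (k , M , N) ∉ (4 , 3 , 3) ∷ (8 , 4 , 4) ∷ [])
theorem10 k (suc m) N _ M≤N _ = mk⇔
  (λ E@(_ , D) → let 3≤k = IsFactorialDesign.t≤k D in
    3≤k , k≤M+N m N E , 3≤2^m⇒3≤1+m m (ℕ.≤-trans 3≤k (k≤2^m m N E)) , k≤2^m m N E , λ
      -- In both cases `2 ^ M` equals `2 * k`, and `q` is `k / 4`.
      { (here refl)         → no-tight-square {q = 1} refl refl E
      ; (there (here refl)) → no-tight-square {q = 2} refl refl E })
  (λ (3≤k , k≤ , 3≤ , k≤2ᵐ , ∉) → config-design {m = m} 3≤k (config-exists k≤ 3≤ M≤N k≤2ᵐ ∉))
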